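{- Consider computations based on the point-hyperplane incidence graph of the 5-dimensional projective space $\mathbb{P}(5,\mathbb{GF}(2))$. It is possible to fold the computations and arrange a scheduling that can be executed using 9 processing units and 9 dual port memories; that is, there exists a folded conflict-free schedule for this graph (in the sense defined in the context) with $N=9$.
   Context: $\mathbb{P}(5,\mathbb{GF}(2))$ is the projective space of a 6-dimensional vector space $\mathbb{V}$ over $\mathbb{GF}(2)$. Points are the 63 one-dimensional vector subspaces of $\mathbb{V}$; hyperplanes are the 63 five-dimensional vector subspaces of $\mathbb{V}$. The point-hyperplane incidence graph is the bipartite graph with one vertex per point and one vertex per hyperplane, and an edge between a point and a hyperplane iff the point is contained in the hyperplane; every vertex has degree 31. Let $E$ be its edge set. Each edge represents one data word. Each vertex represents an atomic computation that reads, and afterwards updates, the data words of all edges incident with that vertex. The overall computation has two phases: in Phase 1 all point vertices compute, in Phase 2 all hyperplane vertices compute. A folded conflict-free schedule with $N$ processing units and $N$ dual port memories consists of the following. (1) A partition of the point set into $N$ blocks $A_1,\dots,A_N$ of equal size and a partition of the hyperplane set into $N$ blocks $B_1,\dots,B_N$ of equal size. Processing unit $i$ performs, one vertex at a time, the computations of the points of $A_i$ in Phase 1 and of the hyperplanes of $B_i$ in Phase 2. (2) A map $\mu:E\to\{1,\dots,N\}$ assigning to each data word the memory in which it is stored; the word is read from and written back to the same location of this memory throughout both phases (no data is moved between memories). (3) For each phase and each unit $i$, an ordering $e_{i,1},\dots,e_{i,R}$ (with $R=31\cdot 63/N$) of all edges incident with the vertices of the block of unit $i$ in that phase, in which the 31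 edges incident with any given vertex are consecutive, and such that for every time step $r\in\{1,\dots,R\}$ the memories $\mu(e_{1,r}),\dots,\mu(e_{N,r})$ are pairwise distinct. Thus at each step every unit accesses exactly one word (no unit is idle) and no two units access the same memory. Inputs are read in this order through one port of the memories, and the outputs are written back in the same order through the second port. -}

module Defs where

open import Level using (Level; 0ℓ; suc; _⊔_)
open import Data.Bool.Base using (Bool; false; _xor_; _∧_)
open import Data.Fin.Base using (Fin; _≤_)
open import Data.Nat.Base as ℕ using (ℕ; NonZero)
open import Data.Nat.DivMod using (_/_)
open import Data.Product.Base using (Σ; ∃; _×_; _,_; proj₁; proj₂)
open import Data.Product.Relation.Binary.Pointwise.NonDependent using (×-setoid)
open import Data.Vec.Base using (Vec; replicate; map; zipWith; foldr′)
open import Data.Vec.Relation.Unary.All using (All)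
open import Function.Bundles using (Func; Inverse)
open import Function.Construct.Composition using (function)
open import Function.Definitions using (Injective)
open import Relation.Binary.Bundles using (Setoid)
open import Relation.Binary.PropositionalEquality.Core using (_≡_)
open import Relation.Binary.PropositionalEquality.Properties using (setoid)
open import Relation.Unary using (Pred; _∈_; _⊆_; _≐_)
open import Relation.Unary.Properties using (≐-refl; ≐-sym; ≐-trans)
import Relation.Binary.Construct.On as On

private
  variable
    a ℓ b ℓ′ : Level

-- The field with two elements is the carrier of the standard library's
-- xor-∧-commutativeRing.
GF2 : Set
GF2 = Bool

V : ℕ → Set
V n = Vec GF2 n

module _ {n : ℕ} where

  infixl 6 _⊕_
  infixr 7 _·_

  𝟎 : V n
  𝟎 = replicate n false

  _⊕_ : V n → V n → V n
  _⊕_ = zipWith _xor_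

  _·_ : GF2 → V n → V n
  c · v = map (c ∧_) v

  combination : ∀ {k} → Vec GF2 k → Vec (V n) k → V n
  combination cs vs = foldr′ _⊕_ 𝟎 (zipWith _·_ cs vs)

  record IsSubspace (W : Pred (V n) 0ℓ) : Set where
    field
      𝟎-closed : 𝟎 ∈ W
      ⊕-closed : ∀ {u v} → u ∈ W → v ∈ W → u ⊕ v ∈ W
      ·-closed : ∀ c {v} → v ∈ W → c · v ∈ W

  record IsBasis {k : ℕ} (W : Pred (V n) 0ℓ) (vs : Vec (V n) k) : Set where
    field
      members     : All W vs
      independent : ∀ cs → combination cs vs ≡ 𝟎 → cs ≡ replicate k false
      spanning    : ∀ {v} → v ∈ W → ∃ λ cs → combination cs vs ≡ v

record Subspace (n k : ℕ) : Set₁ where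
  field
    vectors    : Pred (V n) 0ℓ
    isSubspace : IsSubspace vectors
    dimension  : Σ (Vec (V n) k) (IsBasis vectors)

open Subspace public using (vectors)

-- Two subspaces are equal when they contain the same vectors; the basis
-- witnessing the dimension is irrelevant.
SubspaceSetoid : ℕ → ℕ → Setoid (suc 0ℓ) 0ℓ
SubspaceSetoid n k = record
  { Carrier       = Subspace n k
  ; _≈_           = λ U W → vectors U ≐ vectors W
  ; isEquivalence = record { refl = ≐-refl ; sym = ≐-sym ; trans = ≐-trans }
  }

record BipartiteGraph a ℓ : Set (suc (a ⊔ ℓ)) where
  field
    Left Right : Setoid a ℓ
    Adjacent   : Setoid.Carrier Left → Setoid.Carrier Right → Set ℓ

  -- There are no multiple edges: an edge is determined by its ends.
  Edges : Setoid (a ⊔ ℓ) ℓ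
  Edges = On.setoid {B = Σ (Setoid.Carrier Left × Setoid.Carrier Right)
                           (λ (x , y) → Adjacent x y)}
                    (×-setoid Left Right) proj₁

  leftEnd : Func Edges Left
  leftEnd = record { to = λ e → proj₁ (proj₁ e) ; cong = proj₁ }

  rightEnd : Func Edges Right
  rightEnd = record { to = λ e → proj₂ (proj₁ e) ; cong = proj₂ }

-- The point-hyperplane incidence graph of ℙ(d, GF(2)).
pointHyperplaneGraph : ℕ → BipartiteGraph (suc 0ℓ) 0ℓ
pointHyperplaneGraph d = record
  { Left     = SubspaceSetoid (ℕ.suc d) 1
  ; Right    = SubspaceSetoid (ℕ.suc d) d
  ; Adjacent = λ p h → vectors p ⊆ vectors h
  }

Fibre : {S : Setoid a ℓ} {N : ℕ} → Func S (setoid (Fin N)) → Fin N → Setoid a ℓ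
Fibre {S = S} f i =
  On.setoid {B = Σ (Setoid.Carrier S) (λ x → Func.to f x ≡ i)} S proj₁

-- A partition into N labelled blocks of equal size; the blocks are the fibres
-- of the labelling.
record EqualPartition (S : Setoid a ℓ) (N : ℕ) : Set (a ⊔ ℓ) where
  field
    block     : Func S (setoid (Fin N))
    blockSize : ℕ
    enumerate : ∀ i → Inverse (setoid (Fin blockSize)) (Fibre block i)

-- One phase: the vertices of X compute, `end` sends an edge to its end in X,
-- and the vertices of X are distributed over the units by `block`.
record PhaseSchedule {E : Setoid a ℓ} {X : Setoid b ℓ′} {N : ℕ} (R : ℕ)
                     (end : Func E X)
                     (block : Func X (setoid (Fin N)))
                     (memory : Func E (setoid (Fin N)))
                     : Set (a ⊔ ℓ ⊔ ℓ′) where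
  field
    order : ∀ i → Inverse (setoid (Fin R)) (Fibre (function end block) i)

  access : Fin N → Fin R → Setoid.Carrier E
  access i r = proj₁ (Inverse.to (order i) r)

  active : Fin N → Fin R → Setoid.Carrier X
  active i r = Func.to end (access i r)

  open Setoid X using (_≈_)

  field
    consecutive  : ∀ i {r s t} → r ≤ s → s ≤ t →
                   active i r ≈ active i t → active i s ≈ active i r
    conflictFree : ∀ r → Injective _≡_ _≡_ (λ i → Func.to memory (access i r))

record Schedule (G : BipartiteGraph a ℓ) (N R : ℕ) : Set (a ⊔ ℓ) where
  open BipartiteGraph G
  field
    leftBlocks  : EqualPartition Left N
    rightBlocks : EqualPartition Right N
    memory      : Func Edges (setoid (Fin N))
    phase₁      : PhaseSchedule R leftEnd (EqualPartition.block leftBlocks) memory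
    phase₂      : PhaseSchedule R rightEnd (EqualPartition.block rightBlocks) memory

-- In ℙ(5, GF(2)) there are 63 points and 63 hyperplanes, each on 31 edges, so
-- every unit makes 31 * 63 / N accesses per phase.  The division is exact
-- whenever a schedule exists, since blocks of equal size force N to divide 63.
FoldedConflictFreeSchedule : (N : ℕ) → .{{NonZero N}} → Set₁
FoldedConflictFreeSchedule N =
  Schedule (pointHyperplaneGraph 5) N ((31 ℕ.* 63) / N)

-- A Singer cycle acts regularly on the points and on the hyperplanes.  If both
-- are indexed by ℤ/63 along this action, point i lies on hyperplane j exactly
-- when i + j belongs to a fixed set D of 31 residues.  Unit u gets the points
-- and the hyperplanes whose index is u modulo 9, and every word is stored in the
-- memory numbered like the unit of its point.  In Phase 1 each unit then only
-- uses its own memory.  In Phase 2 all units simultaneously access the points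
-- d − j for a common d ∈ D, where the indices j of the active hyperplanes are
-- pairwise distinct modulo 9; as 9 divides 63, so are the d − j.
module Submission where

open import Defs
open import Algebra.Bundles using (CommutativeSemigroup)
open import Algebra.Properties.CommutativeSemigroup using (interchange; xy∙z≈xz∙y)
open import Data.Bool.Base using (true; false; _xor_; _∧_)
open import Data.Bool.Properties
  using (_≟_; xor-assoc; xor-comm; xor-identityʳ; xor-same; not-injective;
         ∧-distribˡ-xor; ∧-distribʳ-xor; ∧-comm; ∧-zeroʳ; ∧-identityʳ)
open import Data.Fin.Base
  using (Fin; zero; suc; toℕ; combine; quotient; remainder; _≤_)
open import Data.Fin.Properties as Fin
  using (toℕ-injective; toℕ-fromℕ<; toℕ<n; toℕ≤n; toℕ-combine; combine-remQuot; remQuot-combine;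
         combine-injectiveˡ; combine-monoˡ-<; ≤-antisym; <⇒≢; pigeonhole; 2↔Bool; *↔×)
open import Data.List.Base using (List; lookup; filter; allFin)
open import Data.List.Membership.Propositional using () renaming (_∈_ to _∈ˡ_)
open import Data.List.Membership.Propositional.Properties
  using (∈-filter⁺; ∈-filter⁻; ∈-lookup; ∈-allFin)
import Data.List.Relation.Unary.All as List using (lookup)
open import Data.List.Relation.Unary.AllPairs using (_∷_)
open import Data.List.Relation.Unary.Any using (index)
open import Data.List.Relation.Unary.Any.Properties using (lookup-index)
open import Data.List.Relation.Unary.Unique.Propositional using (Unique)
open import Data.List.Relation.Unary.Unique.Propositional.Properties using (filter⁺; allFin⁺)
open import Data.Nat.Base as ℕ using (ℕ; NonZero; zero; suc; _+_; _*_; _∸_; _^_)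
open import Data.Nat.DivMod
  using (_%_; _mod_; %-distribˡ-+; [m+n]%n≡m%n; [m+kn]%n≡m%n; m<n⇒m%n≡m; m%n%n≡m%n;
         m∣n⇒o%n%m≡o%m; m%n<n)
open import Data.Nat.Divisibility using (n∣m*n)
open import Data.Nat.GeneralisedArithmetic using (fold)
import Data.Nat.Properties as ℕ
open import Data.Product.Base using (Σ; ∃; _×_; _,_; proj₁; proj₂)
open import Data.Product.Function.NonDependent.Propositional using (_×-↔_)
open import Data.Vec.Base using (Vec; []; _∷_; map; uncons; head; tail)
open import Data.Vec.Properties
  using (≡-dec; zipWith-assoc; zipWith-comm; zipWith-identityʳ; zipWith-identityˡ)
open import Data.Vec.Relation.Unary.All using (All; []; _∷_)
open import Function.Base using (_∘_)
open import Function.Bundles using (Func; Injection; Inverse; _↔_; mk↔ₛ′)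
open import Function.Construct.Composition using (function; inverse)
open import Function.Definitions using (Injective)
open import Function.Properties.Inverse using (fromFunction; ↔-sym; ↔-trans; ↔⇒↣)
open import Level using (Level; 0ℓ)
open import Relation.Binary.Bundles using (Setoid)
import Relation.Binary.Construct.On as On
open import Relation.Binary.PropositionalEquality
open import Relation.Binary.PropositionalEquality.Algebra using (isMagma)
open import Relation.Nullary.Decidable using (Dec; map′; from-yes; ¬?; _→-dec_; _×-dec_)
open import Relation.Nullary.Negation using (contradiction)
open import Relation.Unary using (Pred; Decidable; _∈_; _⊆_)

private
  variable
    a ℓ b ℓ′ : Level
    k m n q : ℕ

-- Arithmetic modulo n

%-congʳ-+ : ∀ k l n .{{_ : NonZero n}} → (k + l % n) % n ≡ (k + l) % n
%-congʳ-+ k l n = begin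
  (k + l % n) % n           ≡⟨ %-distribˡ-+ k (l % n) n ⟩
  (k % n + l % n % n) % n   ≡⟨ cong (λ r → (k % n + r) % n) (m%n%n≡m%n l n) ⟩
  (k % n + l % n) % n       ≡⟨ %-distribˡ-+ k l n ⟨
  (k + l) % n               ∎
  where open ≡-Reasoning

module _ {n : ℕ} .{{_ : NonZero n}} where

  infixl 6 _⊞_ _⊟_

  -- Addition and subtraction in the cyclic group of order `n`. In `d ⊟ i` the summand `n` keeps the
  -- truncated `∸` exact, because `toℕ i` is at most `n`.
  _⊞_ _⊟_ : Fin n → Fin n → Fin n
  i ⊞ j = (toℕ i + toℕ j) mod n
  d ⊟ i = ((n ∸ toℕ i) + toℕ d) mod n

  toℕ-mod : ∀ k → toℕ (k mod n) ≡ k % n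
  toℕ-mod k = toℕ-fromℕ< (m%n<n k n)

  toℕ-%-id : ∀ (i : Fin n) → toℕ i % n ≡ toℕ i
  toℕ-%-id i = m<n⇒m%n≡m (toℕ<n i)

  ⊞-comm : ∀ i j → i ⊞ j ≡ j ⊞ i
  ⊞-comm i j = cong (_mod n) (ℕ.+-comm (toℕ i) (toℕ j))

  ⊞-⊟ : ∀ i d → i ⊞ (d ⊟ i) ≡ d
  ⊞-⊟ i d = toℕ-injective (begin
    toℕ (i ⊞ (d ⊟ i))                       ≡⟨ toℕ-mod _ ⟩
    (toℕ i + toℕ (d ⊟ i)) % n               ≡⟨ cong (λ k → (toℕ i + k) % n) (toℕ-mod _) ⟩
    (toℕ i + ((n ∸ toℕ i) + toℕ d) % n) % n ≡⟨ %-congʳ-+ (toℕ i) _ n ⟩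
    (toℕ i + ((n ∸ toℕ i) + toℕ d)) % n     ≡⟨ cong (_% n) (ℕ.+-assoc (toℕ i) _ _) ⟨
    (toℕ i + (n ∸ toℕ i) + toℕ d) % n       ≡⟨ cong (λ k → (k + toℕ d) % n) (ℕ.m+[n∸m]≡n (toℕ≤n i)) ⟩
    (n + toℕ d) % n                         ≡⟨ cong (_% n) (ℕ.+-comm n (toℕ d)) ⟩
    (toℕ d + n) % n                         ≡⟨ [m+n]%n≡m%n (toℕ d) n ⟩
    toℕ d % n                               ≡⟨ toℕ-%-id d ⟩
    toℕ d ∎)
    where open ≡-Reasoning

  ⊟-⊞ : ∀ i j → (i ⊞ j) ⊟ i ≡ j
  ⊟-⊞ i j = toℕ-injective (begin
    toℕ ((i ⊞ j) ⊟ i)                       ≡⟨ toℕ-mod _ ⟩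
    ((n ∸ toℕ i) + toℕ (i ⊞ j)) % n         ≡⟨ cong (λ k → ((n ∸ toℕ i) + k) % n) (toℕ-mod _) ⟩
    ((n ∸ toℕ i) + (toℕ i + toℕ j) % n) % n ≡⟨ %-congʳ-+ (n ∸ toℕ i) _ n ⟩
    ((n ∸ toℕ i) + (toℕ i + toℕ j)) % n     ≡⟨ cong (_% n) (ℕ.+-assoc (n ∸ toℕ i) _ _) ⟨
    ((n ∸ toℕ i) + toℕ i + toℕ j) % n       ≡⟨ cong (λ k → (k + toℕ j) % n) (ℕ.m∸n+n≡m (toℕ≤n i)) ⟩
    (n + toℕ j) % n                         ≡⟨ cong (_% n) (ℕ.+-comm n (toℕ j)) ⟩
    (toℕ j + n) % n                         ≡⟨ [m+n]%n≡m%n (toℕ j) n ⟩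
    toℕ j % n                               ≡⟨ toℕ-%-id j ⟩
    toℕ j ∎)
    where open ≡-Reasoning

  -- For fixed `d`, the pairs with sum `d` form the graph of the reflection sending `i` to `d ⊟ i`.
  -- This is what allows an edge to be addressed from either of its ends.
  ⊟-involutive : ∀ d i → d ⊟ (d ⊟ i) ≡ i
  ⊟-involutive d i = begin
    d ⊟ (d ⊟ i)                  ≡⟨ cong (_⊟ (d ⊟ i)) (trans (⊞-comm (d ⊟ i) i) (⊞-⊟ i d)) ⟨
    ((d ⊟ i) ⊞ i) ⊟ (d ⊟ i)      ≡⟨ ⊟-⊞ (d ⊟ i) i ⟩
    i                            ∎
    where open ≡-Reasoning

toℕ-remainder : ∀ {m} N .{{_ : NonZero N}} (k : Fin (m * N)) →
                toℕ (remainder {m} N k) ≡ toℕ k % N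
toℕ-remainder {m} N k = begin
  toℕ u                   ≡⟨ toℕ-%-id u ⟨
  toℕ u % N               ≡⟨ [m+kn]%n≡m%n (toℕ u) (toℕ t) N ⟨
  (toℕ u + toℕ t * N) % N ≡⟨ cong (_% N) (ℕ.+-comm (toℕ u) _) ⟩
  (toℕ t * N + toℕ u) % N ≡⟨ cong (λ r → (r + toℕ u) % N) (ℕ.*-comm (toℕ t) N) ⟩
  (N * toℕ t + toℕ u) % N ≡⟨ cong (_% N) (toℕ-combine t u) ⟨
  toℕ (combine t u) % N   ≡⟨ cong (λ r → toℕ r % N) (combine-remQuot {m} N k) ⟩
  toℕ k % N               ∎
  where
  open ≡-Reasoning
  t = quotient {m} N k
  u = remainder {m} N k

-- By contraposition: a strictly smaller quotient gives a strictly smaller number, whatever the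
-- remainders are.
quotient-mono-≤ : ∀ {m} n {r s : Fin (m * n)} → r ≤ s → quotient {m} n r ≤ quotient {m} n s
quotient-mono-≤ {m} n {r} {s} r≤s = ℕ.≮⇒≥ λ q< → ℕ.<⇒≱
  (combine-monoˡ-< (remainder {m} n s) (remainder {m} n r) q<)
  (subst₂ _≤_ (sym (combine-remQuot {m} n r)) (sym (combine-remQuot {m} n s)) r≤s)

-- Schedules from cyclic incidence structures

module Cyclic (m N : ℕ) .{{_ : NonZero N}} .{{_ : NonZero (m * N)}} where

  -- An index `k` is `row k * N + residue k`: the residue names the unit, and the row is the turn of
  -- the vertex within that unit.
  row : Fin (m * N) → Fin m
  row = quotient {m} N

  residue : Fin (m * N) → Fin N
  residue = remainder {m} N

  residue-combine : ∀ (t : Fin m) u → residue (combine t u) ≡ u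
  residue-combine t u = cong proj₂ (remQuot-combine t u)

  combine-residue : ∀ {k u} → residue k ≡ u → combine (row k) u ≡ k
  combine-residue {k} refl = combine-remQuot {m} N k

  -- The right-hand side sees `k` only through its residue. Reduction modulo `m * N` preserves
  -- classes modulo `N`, and `k` exceeds its residue by a multiple of `N`.
  toℕ-residue-⊟ : ∀ d (k : Fin (m * N)) →
    toℕ (residue (d ⊟ k)) ≡ ((m * N ∸ toℕ (residue k)) + toℕ d) % N
  toℕ-residue-⊟ d k = begin
    toℕ (residue (d ⊟ k))                        ≡⟨ toℕ-remainder {m} N (d ⊟ k) ⟩
    toℕ (d ⊟ k) % N                              ≡⟨ cong (_% N) (toℕ-mod _) ⟩
    ((m * N ∸ toℕ k) + toℕ d) % (m * N) % N      ≡⟨ m∣n⇒o%n%m≡o%m N (m * N) _ (n∣m*n m) ⟩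
    ((m * N ∸ toℕ k) + toℕ d) % N                ≡⟨ [m+kn]%n≡m%n _ (toℕ t) N ⟨
    ((m * N ∸ toℕ k) + toℕ d + toℕ t * N) % N    ≡⟨ cong (_% N) lemma ⟩
    ((m * N ∸ toℕ u) + toℕ d) % N                ∎
    where
    open ≡-Reasoning
    t = row k
    u = residue k
    k≡ : toℕ k ≡ toℕ u + toℕ t * N
    k≡ = begin
      toℕ k               ≡⟨ cong toℕ (combine-remQuot {m} N k) ⟨
      toℕ (combine t u)   ≡⟨ toℕ-combine t u ⟩
      N * toℕ t + toℕ u   ≡⟨ ℕ.+-comm _ (toℕ u) ⟩
      toℕ u + N * toℕ t   ≡⟨ cong (toℕ u +_) (ℕ.*-comm N (toℕ t)) ⟩
      toℕ u + toℕ t * N   ∎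
    -- This bound lets the truncated subtraction of `toℕ t * N` be undone by adding it back.
    tN≤ : toℕ t * N ℕ.≤ m * N ∸ toℕ u
    tN≤ = subst (ℕ._≤ m * N ∸ toℕ u)
            (trans (cong (_∸ toℕ u) k≡) (ℕ.m+n∸m≡n (toℕ u) _))
            (ℕ.∸-monoˡ-≤ (toℕ u) (toℕ≤n k))
    lemma : (m * N ∸ toℕ k) + toℕ d + toℕ t * N ≡ (m * N ∸ toℕ u) + toℕ d
    lemma = begin
      (m * N ∸ toℕ k) + toℕ d + toℕ t * N
        ≡⟨ xy∙z≈xz∙y ℕ.+-commutativeSemigroup (m * N ∸ toℕ k) (toℕ d) (toℕ t * N) ⟩
      (m * N ∸ toℕ k) + toℕ t * N + toℕ d
        ≡⟨ cong (λ r → (m * N ∸ r) + toℕ t * N + toℕ d) k≡ ⟩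
      (m * N ∸ (toℕ u + toℕ t * N)) + toℕ t * N + toℕ d
        ≡⟨ cong (λ r → r + toℕ t * N + toℕ d) (ℕ.∸-+-assoc (m * N) (toℕ u) _) ⟨
      (m * N ∸ toℕ u ∸ toℕ t * N) + toℕ t * N + toℕ d
        ≡⟨ cong (_+ toℕ d) (ℕ.m∸n+n≡m tN≤) ⟩
      (m * N ∸ toℕ u) + toℕ d
        ∎

  residue-⊟-cong : ∀ d {k l} → residue k ≡ residue l → residue (d ⊟ k) ≡ residue (d ⊟ l)
  residue-⊟-cong d {k} {l} eq = toℕ-injective (begin
    toℕ (residue (d ⊟ k))                       ≡⟨ toℕ-residue-⊟ d k ⟩
    ((m * N ∸ toℕ (residue k)) + toℕ d) % N     ≡⟨ cong (λ u → ((m * N ∸ toℕ u) + toℕ d) % N) eq ⟩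
    ((m * N ∸ toℕ (residue l)) + toℕ d) % N     ≡⟨ toℕ-residue-⊟ d l ⟨
    toℕ (residue (d ⊟ l))                       ∎)
    where open ≡-Reasoning

  -- Reflection respects congruence modulo `N` and is its own inverse, so it also reflects
  -- congruence. Conflict-freeness of Phase 2 rests on this.
  residue-⊟-injective : ∀ d {k l} → residue (d ⊟ k) ≡ residue (d ⊟ l) → residue k ≡ residue l
  residue-⊟-injective d {k} {l} eq = begin
    residue k              ≡⟨ cong residue (⊟-involutive d k) ⟨
    residue (d ⊟ (d ⊟ k))  ≡⟨ residue-⊟-cong d eq ⟩
    residue (d ⊟ (d ⊟ l))  ≡⟨ cong residue (⊟-involutive d l) ⟩
    residue l              ∎
    where open ≡-Reasoning

  -- Blocks and access orders for one class of vertices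

  module _ {X : Setoid a ℓ} (vertices : Inverse (setoid (Fin (m * N))) X) where

    private
      module X = Setoid X
      module vertices = Inverse vertices

    residueBlock : Func X (setoid (Fin N))
    residueBlock = function (fromFunction vertices) (record { to = residue; cong = cong residue })

    -- Every row contains exactly one index of each residue, so `row` numbers each block by `Fin m`.
    residuePartition : EqualPartition X N
    residuePartition = record
      { block     = residueBlock
      ; blockSize = m
      ; enumerate = λ i → record
        { to        = λ t → vertices.to (combine t i) ,
                            trans (cong residue (vertices.strictlyInverseʳ _)) (residue-combine t i)
        ; from      = λ (x , _) → row (vertices.from x)
        ; to-cong   = λ { refl → X.refl }
        ; from-cong = λ x≈y → cong row (vertices.from-cong x≈y)
        ; inverse   =
            (λ { {_ , x∈i} refl →
                 X.trans (vertices.to-cong (combine-residue x∈i)) (vertices.strictlyInverseˡ _) })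
          , (λ { {t} x≈ →
                 trans (cong row (vertices.inverseʳ x≈)) (cong proj₁ (remQuot-combine t i)) })
        }
      }

    -- Unit i runs through its vertices i, i + N, i + 2N, … and takes the q edges
    -- at each of them in the order given by the second index.
    phaseSchedule : {E : Setoid b ℓ′} (end : Func E X) (memory : Func E (setoid (Fin N)))
      (edges : Inverse (setoid (Fin (m * N) × Fin q)) E) →
      (∀ k d → Func.to end (Inverse.to edges (k , d)) X.≈ vertices.to k) →
      (∀ t d → Injective _≡_ _≡_ (λ i → Func.to memory (Inverse.to edges (combine t i , d)))) →
      PhaseSchedule (m * q) end residueBlock memory
    phaseSchedule {q = q} {E = E} end memory edges end≈ distinct = record
      { order        = λ i → record
        { to        = λ r → edges.to (address i r) ,
                            trans (cong residue (label _ _)) (residue-combine _ i)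
        ; from      = λ (e , _) → position (edges.from e)
        ; to-cong   = λ { refl → E.refl }
        ; from-cong = λ e≈f → cong position (edges.from-cong e≈f)
        ; inverse   =
            (λ { {e , e∈i} refl → E.trans
                 (edges.to-cong (address-position (trans (cong residue (label-from e)) e∈i)))
                 (edges.strictlyInverseˡ e) })
          , (λ { {r} e≈ → trans (cong position (edges.inverseʳ e≈)) (position-address i r) })
        }
      ; consecutive  = λ i {r} {s} {t} r≤s s≤t r≈t →
          -- The active vertex of unit `i` determines its slot. Slots never decrease with time, so
          -- equal slots at `r` and `t` force the same slot at `s` between them.
          let slot-r≡slot-t : slot r ≡ slot t
              slot-r≡slot-t = combine-injectiveˡ _ i _ i
                (trans (sym (label _ _)) (trans (vertices.from-cong r≈t) (label _ _)))
              slot-s≡slot-r : slot s ≡ slot r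
              slot-s≡slot-r = ≤-antisym
                (subst (slot s ≤_) (sym slot-r≡slot-t) (quotient-mono-≤ {m} q s≤t))
                (quotient-mono-≤ {m} q r≤s)
          in X.trans (end≈ _ _) (X.trans
               (vertices.to-cong (cong (λ t′ → combine t′ i) slot-s≡slot-r)) (X.sym (end≈ _ _)))
      ; conflictFree = λ r → distinct (slot r) (remainder {m} q r)
      }
      where
      module E = Setoid E
      module edges = Inverse edges

      slot : Fin (m * q) → Fin m
      slot = quotient {m} q

      address : Fin N → Fin (m * q) → Fin (m * N) × Fin q
      address i r = combine (slot r) i , remainder {m} q r

      position : Fin (m * N) × Fin q → Fin (m * q)
      position (k , d) = combine (row k) d

      position-address : ∀ i r → position (address i r) ≡ r
      position-address i r = trans
        (cong (λ t → combine t (remainder {m} q r)) (cong proj₁ (remQuot-combine (slot r) i)))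
        (combine-remQuot {m} q r)

      address-position : ∀ {i k d} → residue k ≡ i → address i (position (k , d)) ≡ (k , d)
      address-position {i} {k} {d} k∈i = cong₂ _,_
        (trans (cong (λ t → combine t i) (cong proj₁ (remQuot-combine (row k) d)))
          (combine-residue k∈i))
        (cong proj₂ (remQuot-combine (row k) d))

      label : ∀ k d → vertices.from (Func.to end (edges.to (k , d))) ≡ k
      label k d = vertices.inverseʳ (end≈ k d)

      label-from : ∀ e → proj₁ (edges.from e) ≡ vertices.from (Func.to end e)
      label-from e = trans (sym (label _ _))
        (vertices.from-cong (Func.cong end (edges.strictlyInverseˡ e)))

  -- Numbering the edges from both sides

  module _ (G : BipartiteGraph a ℓ) {q : ℕ}
    (left  : Inverse (setoid (Fin (m * N))) (BipartiteGraph.Left G))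
    (right : Inverse (setoid (Fin (m * N))) (BipartiteGraph.Right G))
    (D : Fin q → Fin (m * N)) (D-injective : Injective _≡_ _≡_ D)
    where

    open BipartiteGraph G

    private
      module left  = Inverse left
      module right = Inverse right

    cyclicSchedule :
      (∀ i j k → i ⊞ j ≡ D k → Adjacent (left.to i) (right.to j)) →
      (∀ x y → Adjacent x y → ∃ λ k → left.from x ⊞ right.from y ≡ D k) →
      Schedule G N (m * q)
    cyclicSchedule adjacent adjacent⁻¹ = record
      { leftBlocks  = residuePartition left
      ; rightBlocks = residuePartition right
      ; memory      = function leftEnd (residueBlock left)
      ; phase₁      = phaseSchedule left leftEnd _ edgesAtLeft (λ _ _ → Left.refl)
          λ t d {i} {j} eq → begin
            i                                             ≡⟨ residue-combine t i ⟨
            residue (combine t i)                         ≡⟨ memory≡ (combine t i) ⟨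
            residue (left.from (left.to (combine t i)))   ≡⟨ eq ⟩
            residue (left.from (left.to (combine t j)))   ≡⟨ memory≡ (combine t j) ⟩
            residue (combine t j)                         ≡⟨ residue-combine t j ⟩
            j                                             ∎
      ; phase₂      = phaseSchedule right rightEnd _ edgesAtRight
          -- The hyperplane of the edge addressed by `(j , k)` has index `D k ⊟ (D k ⊟ j)`.
          (λ j k → right.to-cong (⊟-involutive (D k) j))
          λ t d {i} {j} eq → begin
            i                       ≡⟨ residue-combine t i ⟨
            residue (combine t i)   ≡⟨ residue-⊟-injective (D d)
                                         (trans (sym (memory≡ _)) (trans eq (memory≡ _))) ⟩
            residue (combine t j)   ≡⟨ residue-combine t j ⟩
            j                       ∎
      }
      where
      open ≡-Reasoning
      module Left = Setoid Left
      module Right = Setoid Right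

      offset : ∀ {x y} → Adjacent x y → Fin q
      offset xy = proj₁ (adjacent⁻¹ _ _ xy)

      ⊞≡D : ∀ {x y} (xy : Adjacent x y) → left.from x ⊞ right.from y ≡ D (offset xy)
      ⊞≡D xy = proj₂ (adjacent⁻¹ _ _ xy)

      -- Edge equality compares only the ends, so the offset must not depend on the adjacency proof;
      -- injectivity of `D` ensures this.
      offset-unique : ∀ {x y k} (xy : Adjacent x y) → left.from x ⊞ right.from y ≡ D k →
                      offset xy ≡ k
      offset-unique xy eq = D-injective (trans (sym (⊞≡D xy)) eq)

      memory≡ : ∀ i → residue (left.from (left.to i)) ≡ residue i
      memory≡ i = cong residue (left.strictlyInverseʳ i)

      edgesAtLeft : Inverse (setoid (Fin (m * N) × Fin q)) Edges
      edgesAtLeft = record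
        { to        = λ (i , k) → (left.to i , right.to (D k ⊟ i)) , adjacent i _ k (⊞-⊟ i (D k))
        ; from      = λ ((x , _) , xy) → left.from x , offset xy
        ; to-cong   = λ { refl → Left.refl , Right.refl }
        ; from-cong = λ { {_ , xy} {_ , x′y′} (x≈x′ , y≈y′) → cong₂ _,_
            (left.from-cong x≈x′)
            (offset-unique xy (trans
              (cong₂ _⊞_ (left.from-cong x≈x′) (right.from-cong y≈y′)) (⊞≡D x′y′))) }
        ; inverse   =
            (λ { {(x , y) , xy} refl → left.strictlyInverseˡ x ,
                 right.inverseˡ (trans (cong (_⊟ left.from x) (sym (⊞≡D xy))) (⊟-⊞ _ _)) })
          , (λ { {i , k} {_ , xy} (x≈ , y≈) → cong₂ _,_
                 (left.inverseʳ x≈)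
                 (offset-unique xy (trans
                   (cong₂ _⊞_ (left.inverseʳ x≈) (right.inverseʳ y≈)) (⊞-⊟ i (D k)))) })
        }

      -- Trades the index of one end of an edge for that of the other while keeping the offset,
      -- since their sum is `D k`.
      reflect : Inverse (setoid (Fin (m * N) × Fin q)) (setoid (Fin (m * N) × Fin q))
      reflect = record
        { to        = λ (j , k) → D k ⊟ j , k
        ; from      = λ (i , k) → D k ⊟ i , k
        ; to-cong   = cong _
        ; from-cong = cong _
        ; inverse   = (λ { refl → cong (_, _) (⊟-involutive _ _) })
                    , (λ { refl → cong (_, _) (⊟-involutive _ _) })
        }

      edgesAtRight : Inverse (setoid (Fin (m * N) × Fin q)) Edges
      edgesAtRight = inverse reflect edgesAtLeft

-- Linear algebra over GF(2)

⊕-identityˡ : ∀ (v : V n) → 𝟎 ⊕ v ≡ v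
⊕-identityˡ = zipWith-identityˡ λ _ → refl

⊕-identityʳ : ∀ (v : V n) → v ⊕ 𝟎 ≡ v
⊕-identityʳ = zipWith-identityʳ xor-identityʳ

⊕-self : ∀ (v : V n) → v ⊕ v ≡ 𝟎
⊕-self []      = refl
⊕-self (b ∷ v) = cong₂ _∷_ (xor-same b) (⊕-self v)

⊕-commutativeSemigroup : ℕ → CommutativeSemigroup 0ℓ 0ℓ
⊕-commutativeSemigroup n = record
  { Carrier = V n
  ; _≈_ = _≡_
  ; _∙_ = _⊕_
  ; isCommutativeSemigroup = record
    { isSemigroup = record
      { isMagma = isMagma _⊕_
      ; assoc = zipWith-assoc xor-assoc
      }
    ; comm = zipWith-comm xor-comm
    }
  }

⊕-interchange : ∀ (t u v w : V n) → (t ⊕ u) ⊕ (v ⊕ w) ≡ (t ⊕ v) ⊕ (u ⊕ w)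
⊕-interchange {n} = interchange (⊕-commutativeSemigroup n)

⊕≡𝟎⇒≡ : ∀ (u v : V n) → u ⊕ v ≡ 𝟎 → u ≡ v
⊕≡𝟎⇒≡ []          []          eq = refl
⊕≡𝟎⇒≡ (false ∷ u) (false ∷ v) eq = cong (false ∷_) (⊕≡𝟎⇒≡ u v (cong tail eq))
⊕≡𝟎⇒≡ (true  ∷ u) (true  ∷ v) eq = cong (true ∷_) (⊕≡𝟎⇒≡ u v (cong tail eq))

·-zero : ∀ (v : V n) → false · v ≡ 𝟎
·-zero []      = refl
·-zero (_ ∷ v) = cong (false ∷_) (·-zero v)

·-one : ∀ (v : V n) → true · v ≡ v
·-one []      = refl
·-one (b ∷ v) = cong (b ∷_) (·-one v)

·-𝟎 : ∀ c → c · 𝟎 {n} ≡ 𝟎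
·-𝟎 false = ·-zero 𝟎
·-𝟎 true  = ·-one 𝟎

·-distribʳ : ∀ c d (v : V n) → (c xor d) · v ≡ c · v ⊕ d · v
·-distribʳ c d []      = refl
·-distribʳ c d (b ∷ v) = cong₂ _∷_ (∧-distribʳ-xor b c d) (·-distribʳ c d v)

-- Linear maps, bases and kernels

Additive : (V m → V n) → Set
Additive f = ∀ u v → f (u ⊕ v) ≡ f u ⊕ f v

module _ {f : V m → V n} (additive : Additive f) where

  additive-𝟎 : f 𝟎 ≡ 𝟎
  additive-𝟎 = begin
    f 𝟎           ≡⟨ cong f (⊕-self 𝟎) ⟨
    f (𝟎 ⊕ 𝟎)     ≡⟨ additive 𝟎 𝟎 ⟩
    f 𝟎 ⊕ f 𝟎     ≡⟨ ⊕-self (f 𝟎) ⟩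
    𝟎             ∎
    where open ≡-Reasoning

  -- Over GF(2) the only scalars are 0 and 1, so additivity already amounts to linearity.
  additive-· : ∀ c v → f (c · v) ≡ c · f v
  additive-· false v = trans (cong f (·-zero v)) (trans additive-𝟎 (sym (·-zero (f v))))
  additive-· true  v = trans (cong f (·-one v)) (sym (·-one (f v)))

  additive-combination : ∀ (cs : V k) vs → combination cs (map f vs) ≡ f (combination cs vs)
  additive-combination []       []       = sym additive-𝟎
  additive-combination (c ∷ cs) (v ∷ vs) = begin
    c · f v ⊕ combination cs (map f vs)
      ≡⟨ cong₂ _⊕_ (sym (additive-· c v)) (additive-combination cs vs) ⟩
    f (c · v) ⊕ f (combination cs vs)
      ≡⟨ additive _ _ ⟨
    f (c · v ⊕ combination cs vs)
      ∎
    where open ≡-Reasoning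

-- Turns linear dependencies into kernel vectors of the coefficient map, so that `additive-kernel`
-- yields one among more than `n` vectors of `V n`.
combination-additive : ∀ (vs : Vec (V n) k) → Additive (λ cs → combination cs vs)
combination-additive []       []       []       = sym (⊕-self 𝟎)
combination-additive (v ∷ vs) (c ∷ cs) (d ∷ ds) =
  trans (cong₂ _⊕_ (·-distribʳ c d v) (combination-additive vs cs ds)) (⊕-interchange _ _ _ _)

standardBasis : ∀ n → Vec (V n) n
standardBasis zero    = []
standardBasis (suc n) = (true ∷ 𝟎) ∷ map (false ∷_) (standardBasis n)

combination-standardBasis : ∀ (v : V n) → combination v (standardBasis n) ≡ v
combination-standardBasis         []      = refl
combination-standardBasis {suc n} (c ∷ v) = begin
  c · (true ∷ 𝟎) ⊕ combination v (map (false ∷_) (standardBasis n))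
    ≡⟨ cong₂ _⊕_ (cong₂ _∷_ (∧-identityʳ c) (·-𝟎 c))
                 (additive-combination (λ _ _ → refl) v (standardBasis n)) ⟩
  (c ∷ 𝟎) ⊕ (false ∷ combination v (standardBasis n))
    ≡⟨ cong₂ _∷_ (xor-identityʳ c) (trans (⊕-identityˡ _) (combination-standardBasis v)) ⟩
  c ∷ v ∎
  where open ≡-Reasoning

-- The combination of the image vectors with coefficients `cs` is `f cs`. Hence independence is
-- triviality of the kernel, and spanning is surjectivity onto `W`.
imageBasis : ∀ {W : Pred (V n) 0ℓ} {f : V k → V n} → Additive f →
             (∀ u → f u ∈ W) → (∀ u → f u ≡ 𝟎 → u ≡ 𝟎) → (∀ {v} → v ∈ W → ∃ λ u → f u ≡ v) →
             IsBasis W (map f (standardBasis k))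
imageBasis {k = k} {f = f} additive f∈ ker im = record
  { members     = all∈ (standardBasis k)
  ; independent = λ cs eq → ker cs (trans (sym (combination≡ cs)) eq)
  ; spanning    = λ v∈W → let u , fu≡v = im v∈W in u , trans (combination≡ u) fu≡v
  }
  where
  combination≡ : ∀ cs → combination cs (map f (standardBasis k)) ≡ f cs
  combination≡ cs = trans (additive-combination additive cs (standardBasis k))
    (cong f (combination-standardBasis cs))
  all∈ : ∀ {l} (us : Vec (V k) l) → All _ (map f us)
  all∈ []       = []
  all∈ (u ∷ us) = f∈ u ∷ all∈ us

-- Counts the vectors, so that the pigeonhole principle applies to maps between these spaces.
V↔Fin : ∀ n → V n ↔ Fin (2 ^ n)
V↔Fin zero    = mk↔ₛ′ (λ _ → zero) (λ _ → []) (λ { zero → refl }) (λ { [] → refl })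
V↔Fin (suc n) = ↔-trans (mk↔ₛ′ uncons (λ (b , v) → b ∷ v) (λ _ → refl) (λ { (_ ∷ _) → refl }))
                 (↔-trans (↔-sym 2↔Bool ×-↔ V↔Fin n) (↔-sym *↔×))

-- Abstract, so that normal vectors of hyperplanes are never computed by search.
abstract
  additive-kernel : ∀ {f : V m → V n} → n ℕ.< m → Additive f → ∃ λ v → v ≢ 𝟎 × f v ≡ 𝟎
  additive-kernel {m} {n} {f} n<m additive
    with i , j , i<j , eq ← pigeonhole (ℕ.^-monoʳ-< 2 ℕ.≤-refl n<m)
                              (Inverse.to (V↔Fin n) ∘ f ∘ Inverse.from (V↔Fin m)) =
      -- Two distinct vectors with the same image; in characteristic 2 their sum is their
      -- difference.
      u ⊕ v
    , (λ u⊕v≡𝟎 → <⇒≢ i<j (Injection.injective (↔⇒↣ (↔-sym (V↔Fin m))) (⊕≡𝟎⇒≡ u v u⊕v≡𝟎)))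
    , (begin
        f (u ⊕ v)     ≡⟨ additive u v ⟩
        f u ⊕ f v     ≡⟨ cong (_⊕ f v) (Injection.injective (↔⇒↣ (V↔Fin n)) eq) ⟩
        f v ⊕ f v     ≡⟨ ⊕-self (f v) ⟩
        𝟎             ∎)
    where
    open ≡-Reasoning
    u v : V m
    u = Inverse.from (V↔Fin m) i
    v = Inverse.from (V↔Fin m) j

-- The standard bilinear form and the kernels of its functionals

infix 8 _∙_

_∙_ : V n → V n → GF2
[]       ∙ []       = false
(a ∷ as) ∙ (b ∷ bs) = (a ∧ b) xor (as ∙ bs)

∙-comm : ∀ (y v : V n) → y ∙ v ≡ v ∙ y
∙-comm []       []       = refl
∙-comm (a ∷ as) (b ∷ bs) = cong₂ _xor_ (∧-comm a b) (∙-comm as bs)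

∙-𝟎 : ∀ (y : V n) → y ∙ 𝟎 ≡ false
∙-𝟎 []      = refl
∙-𝟎 (a ∷ y) = cong₂ _xor_ (∧-zeroʳ a) (∙-𝟎 y)

private
  xor-interchange : ∀ a b c d → (a xor b) xor (c xor d) ≡ (a xor c) xor (b xor d)
  xor-interchange a b c d = cong head (⊕-interchange (a ∷ []) (b ∷ []) (c ∷ []) (d ∷ []))

∙-⊕ : ∀ (y u v : V n) → y ∙ (u ⊕ v) ≡ y ∙ u xor y ∙ v
∙-⊕ []      []      []      = refl
∙-⊕ (a ∷ y) (b ∷ u) (c ∷ v) =
  trans (cong₂ _xor_ (∧-distribˡ-xor a b c) (∙-⊕ y u v)) (xor-interchange (a ∧ b) (a ∧ c) _ _)

∙-· : ∀ c (y v : V n) → y ∙ (c · v) ≡ c ∧ y ∙ v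
∙-· false y v = trans (cong (y ∙_) (·-zero v)) (∙-𝟎 y)
∙-· true  y v = cong (y ∙_) (·-one v)

∙-combination : ∀ (y : V n) {vs : Vec (V n) k} cs → All (λ v → y ∙ v ≡ false) vs →
                y ∙ combination cs vs ≡ false
∙-combination y []       []           = ∙-𝟎 y
∙-combination y {v ∷ vs} (c ∷ cs) (eq ∷ eqs) = begin
  y ∙ (c · v ⊕ combination cs vs)           ≡⟨ ∙-⊕ y _ _ ⟩
  y ∙ (c · v) xor y ∙ combination cs vs     ≡⟨ cong₂ _xor_ (∙-· c y v) (∙-combination y cs eqs) ⟩
  (c ∧ y ∙ v) xor false                     ≡⟨ xor-identityʳ _ ⟩
  c ∧ y ∙ v                                 ≡⟨ cong (c ∧_) eq ⟩
  c ∧ false                                 ≡⟨ ∧-zeroʳ c ⟩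
  false                                     ∎
  where open ≡-Reasoning

-- The first unit vector reads off the first coordinate; vectors beginning with `false` reduce the
-- claim to the tails.
∙-nondegenerate : ∀ (y z : V n) → (∀ v → y ∙ v ≡ z ∙ v) → y ≡ z
∙-nondegenerate []      []      eq = refl
∙-nondegenerate (a ∷ y) (b ∷ z) eq = cong₂ _∷_
  (begin
    a                            ≡⟨ head≡ a y ⟨
    (a ∷ y) ∙ (true ∷ 𝟎)         ≡⟨ eq (true ∷ 𝟎) ⟩
    (b ∷ z) ∙ (true ∷ 𝟎)         ≡⟨ head≡ b z ⟩
    b                            ∎)
  (∙-nondegenerate y z λ v → begin
    y ∙ v                        ≡⟨ tail≡ a y v ⟨
    (a ∷ y) ∙ (false ∷ v)        ≡⟨ eq (false ∷ v) ⟩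
    (b ∷ z) ∙ (false ∷ v)        ≡⟨ tail≡ b z v ⟩
    z ∙ v                        ∎)
  where
  open ≡-Reasoning
  head≡ : ∀ {n} a (y : V n) → (a ∷ y) ∙ (true ∷ 𝟎) ≡ a
  head≡ a y = trans (cong₂ _xor_ (∧-identityʳ a) (∙-𝟎 y)) (xor-identityʳ a)
  tail≡ : ∀ {n} a (y v : V n) → (a ∷ y) ∙ (false ∷ v) ≡ y ∙ v
  tail≡ a y v = cong (_xor (y ∙ v)) (∧-zeroʳ a)

∃-nonorthogonal : ∀ (y : V n) → y ≢ 𝟎 → ∃ λ u → y ∙ u ≡ true
∃-nonorthogonal []          y≢𝟎 = contradiction refl y≢𝟎
∃-nonorthogonal (true  ∷ y) y≢𝟎 = true ∷ 𝟎 , cong (true xor_) (∙-𝟎 y)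
∃-nonorthogonal (false ∷ y) y≢𝟎 =
  let u , yu≡true = ∃-nonorthogonal y (y≢𝟎 ∘ cong (false ∷_)) in false ∷ u , yu≡true

-- In the first non-zero position of y, an orthogonal vector is determined by
-- its other coordinates.
kernelVector : (y : V (suc n)) → y ≢ 𝟎 → V n → V (suc n)
kernelVector         (true  ∷ y) y≢𝟎 v       = y ∙ v ∷ v
kernelVector {zero}  (false ∷ []) y≢𝟎 v      = contradiction refl y≢𝟎
kernelVector {suc n} (false ∷ y) y≢𝟎 (c ∷ v) = c ∷ kernelVector y (y≢𝟎 ∘ cong (false ∷_)) v

kernelVector-additive : ∀ (y : V (suc n)) y≢𝟎 → Additive (kernelVector y y≢𝟎)
kernelVector-additive         (true  ∷ y)  y≢𝟎 u v = cong (_∷ _) (∙-⊕ y u v)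
kernelVector-additive {zero}  (false ∷ []) y≢𝟎 u v = contradiction refl y≢𝟎
kernelVector-additive {suc n} (false ∷ y)  y≢𝟎 (b ∷ u) (c ∷ v) =
  cong (_ ∷_) (kernelVector-additive y _ u v)

∙-kernelVector : ∀ (y : V (suc n)) y≢𝟎 v → y ∙ kernelVector y y≢𝟎 v ≡ false
∙-kernelVector         (true  ∷ y)  y≢𝟎 v       = xor-same (y ∙ v)
∙-kernelVector {zero}  (false ∷ []) y≢𝟎 v       = contradiction refl y≢𝟎
∙-kernelVector {suc n} (false ∷ y)  y≢𝟎 (c ∷ v) = ∙-kernelVector y _ v

kernelVector≡𝟎 : ∀ (y : V (suc n)) y≢𝟎 v → kernelVector y y≢𝟎 v ≡ 𝟎 → v ≡ 𝟎
kernelVector≡𝟎         (true  ∷ y)  y≢𝟎 v       eq = cong tail eq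
kernelVector≡𝟎 {zero}  (false ∷ []) y≢𝟎 v       eq = contradiction refl y≢𝟎
kernelVector≡𝟎 {suc n} (false ∷ y)  y≢𝟎 (c ∷ v) eq =
  cong₂ _∷_ (cong head eq) (kernelVector≡𝟎 y _ v (cong tail eq))

kernelVector-surjective : ∀ (y : V (suc n)) y≢𝟎 v → y ∙ v ≡ false → ∃ λ u → kernelVector y y≢𝟎 u ≡ v
kernelVector-surjective         (true  ∷ y)  y≢𝟎 (false ∷ v) eq = v , cong (_∷ v) eq
-- Here `eq` reduces to `not (y ∙ v) ≡ false`.
kernelVector-surjective         (true  ∷ y)  y≢𝟎 (true ∷ v)  eq = v , cong (_∷ v) (not-injective eq)
kernelVector-surjective {zero}  (false ∷ []) y≢𝟎 v           eq = contradiction refl y≢𝟎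
kernelVector-surjective {suc n} (false ∷ y)  y≢𝟎 (c ∷ v)     eq =
  let u , eq′ = kernelVector-surjective y (y≢𝟎 ∘ cong (false ∷_)) v eq in c ∷ u , cong (c ∷_) eq′

-- Points and hyperplanes as nonzero vectors

NonZeroVectors : ℕ → Setoid 0ℓ 0ℓ
NonZeroVectors n = On.setoid {B = Σ (V n) (_≢ 𝟎)} (setoid (V n)) proj₁

module _ {n : ℕ} where

  hyperplane : (y : V (suc n)) → y ≢ 𝟎 → Subspace (suc n) n
  hyperplane y y≢𝟎 = record
    { vectors    = λ v → y ∙ v ≡ false
    ; isSubspace = record
      { 𝟎-closed = ∙-𝟎 y
      ; ⊕-closed = λ {u} {v} yu yv → trans (∙-⊕ y u v) (cong₂ _xor_ yu yv)
      ; ·-closed = λ c {v} yv → trans (∙-· c y v) (trans (cong (c ∧_) yv) (∧-zeroʳ c))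
      }
    ; dimension  = _ , imageBasis (kernelVector-additive y y≢𝟎) (∙-kernelVector y y≢𝟎)
                         (kernelVector≡𝟎 y y≢𝟎) (λ {v} → kernelVector-surjective y y≢𝟎 v)
    }

  -- The products with the `n` basis vectors form a linear map from dimension `n + 1` to dimension
  -- `n`, which has a nonzero kernel vector.
  normalExists : (W : Subspace (suc n) n) →
    ∃ λ y → y ≢ 𝟎 × All (λ v → y ∙ v ≡ false) (proj₁ (Subspace.dimension W))
  normalExists W =
    let y , y≢𝟎 , eq = additive-kernel {f = products vs} (ℕ.n<1+n n) (products-additive vs)
    in y , y≢𝟎 , orthogonal vs y eq
    where
    vs = proj₁ (Subspace.dimension W)
    products : Vec (V (suc n)) k → V (suc n) → V k
    products vs y = map (y ∙_) vs
    products-additive : (vs : Vec (V (suc n)) k) → Additive (products vs)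
    products-additive []       y z = refl
    products-additive (v ∷ vs) y z = cong₂ _∷_
      (trans (∙-comm _ v) (trans (∙-⊕ v y z) (cong₂ _xor_ (∙-comm v y) (∙-comm v z))))
      (products-additive vs y z)
    orthogonal : ∀ (vs : Vec (V (suc n)) k) y → products vs y ≡ 𝟎 → All (λ v → y ∙ v ≡ false) vs
    orthogonal []       y eq = []
    orthogonal (v ∷ vs) y eq = cong head eq ∷ orthogonal vs y (cong tail eq)

  module _ (W : Subspace (suc n) n) where

    normal : V (suc n)
    normal = proj₁ (normalExists W)

    normal≢𝟎 : normal ≢ 𝟎
    normal≢𝟎 = proj₁ (proj₂ (normalExists W))

    private
      vs : Vec (V (suc n)) n
      vs = proj₁ (Subspace.dimension W)

      normal⊥vs : All (λ v → normal ∙ v ≡ false) vs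
      normal⊥vs = proj₂ (proj₂ (normalExists W))

      open IsBasis (proj₂ (Subspace.dimension W))
      open IsSubspace (Subspace.isSubspace W)

      combination∈W : ∀ {us : Vec (V (suc n)) k} cs → All (vectors W) us →
                      combination cs us ∈ vectors W
      combination∈W []       []         = 𝟎-closed
      combination∈W (c ∷ cs) (u∈ ∷ us∈) = ⊕-closed (·-closed c u∈) (combination∈W cs us∈)

    ∈⇒⊥normal : ∀ {v} → v ∈ vectors W → normal ∙ v ≡ false
    ∈⇒⊥normal v∈W =
      let cs , eq = spanning v∈W
      in trans (cong (normal ∙_) (sym eq)) (∙-combination normal cs normal⊥vs)

    -- With u outside the hyperplane, the n + 2 vectors u, v and the basis of W
    -- are dependent.  The product with the normal shows that u does not occur
    -- in the dependency, so v does.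
    ⊥normal⇒∈ : ∀ {v} → normal ∙ v ≡ false → v ∈ vectors W
    ⊥normal⇒∈ {v} yv with ∃-nonorthogonal normal normal≢𝟎
    ... | u , yu with additive-kernel ℕ.≤-refl (combination-additive (u ∷ v ∷ vs))
    ...   | d ∷ c ∷ cs , ≢𝟎 , eq = conclude d c d≡false ≢𝟎 eq
      where
      open ≡-Reasoning
      d≡false : d ≡ false
      d≡false = begin
        d
          ≡⟨ ∧-identityʳ d ⟨
        d ∧ true
          ≡⟨ cong (d ∧_) yu ⟨
        d ∧ normal ∙ u
          ≡⟨ ∙-· d normal u ⟨
        normal ∙ (d · u)
          ≡⟨ xor-identityʳ _ ⟨
        normal ∙ (d · u) xor false
          ≡⟨ cong (normal ∙ (d · u) xor_) (∙-combination normal (c ∷ cs) (yv ∷ normal⊥vs)) ⟨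
        normal ∙ (d · u) xor normal ∙ combination (c ∷ cs) (v ∷ vs)
          ≡⟨ ∙-⊕ normal _ _ ⟨
        normal ∙ combination (d ∷ c ∷ cs) (u ∷ v ∷ vs)
          ≡⟨ cong (normal ∙_) eq ⟩
        normal ∙ 𝟎
          ≡⟨ ∙-𝟎 normal ⟩
        false
          ∎

      drop-u : ∀ c → combination (false ∷ c ∷ cs) (u ∷ v ∷ vs) ≡ c · v ⊕ combination cs vs
      drop-u c = trans (cong (_⊕ _) (·-zero u)) (⊕-identityˡ _)

      conclude : ∀ d c → d ≡ false → d ∷ c ∷ cs ≢ 𝟎 →
                 combination (d ∷ c ∷ cs) (u ∷ v ∷ vs) ≡ 𝟎 → v ∈ vectors W
      -- Were `v` absent as well, the relation would involve only the basis of `W` and would be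
      -- trivial.
      conclude false false refl ≢𝟎 eq = contradiction (cong (λ es → false ∷ false ∷ es) cs≡𝟎) ≢𝟎
        where
        cs≡𝟎 : cs ≡ 𝟎
        cs≡𝟎 = independent cs (begin
          combination cs vs                               ≡⟨ ⊕-identityˡ _ ⟨
          𝟎 ⊕ combination cs vs                           ≡⟨ cong (_⊕ _) (·-zero v) ⟨
          false · v ⊕ combination cs vs                   ≡⟨ drop-u false ⟨
          combination (false ∷ false ∷ cs) (u ∷ v ∷ vs)   ≡⟨ eq ⟩
          𝟎                                               ∎)
      conclude false true refl ≢𝟎 eq = subst (_∈ vectors W) (sym v≡) (combination∈W cs members)
        where
        v≡ : v ≡ combination cs vs
        v≡ = ⊕≡𝟎⇒≡ v _ (begin
          v ⊕ combination cs vs                           ≡⟨ cong (_⊕ _) (·-one v) ⟨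
          true · v ⊕ combination cs vs                    ≡⟨ drop-u true ⟨
          combination (false ∷ true ∷ cs) (u ∷ v ∷ vs)    ≡⟨ eq ⟩
          𝟎                                               ∎)

  -- Over GF(2) a functional is determined by its kernel, with no scalar left free. The normal is
  -- therefore independent of the basis from which it was obtained.
  hyperplanes : Inverse (NonZeroVectors (suc n)) (SubspaceSetoid (suc n) n)
  hyperplanes = record
    { to        = λ (y , y≢𝟎) → hyperplane y y≢𝟎
    ; from      = λ W → normal W , normal≢𝟎 W
    ; to-cong   = λ { {y , _} {z , _} refl → (λ yv → yv) , (λ yv → yv) }
    ; from-cong = λ {W} {U} (W⊆U , U⊆W) → kernel-injective (normal W) (normal U)
                    (λ v → ∈⇒⊥normal U ∘ W⊆U ∘ ⊥normal⇒∈ W) (λ v → ∈⇒⊥normal W ∘ U⊆W ∘ ⊥normal⇒∈ U)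
    ; inverse   = (λ { {W} refl → ⊥normal⇒∈ W , ∈⇒⊥normal W })
                , (λ { {y , _} {W} (W⊆y , y⊆W) → kernel-injective (normal W) y
                       (λ v → W⊆y ∘ ⊥normal⇒∈ W) (λ v → ∈⇒⊥normal W ∘ y⊆W) })
    }
    where
    -- Functions into GF(2) with the same zeros agree everywhere, so nondegeneracy applies.
    kernel-injective : ∀ (y z : V (suc n)) → (∀ v → y ∙ v ≡ false → z ∙ v ≡ false) →
                       (∀ v → z ∙ v ≡ false → y ∙ v ≡ false) → y ≡ z
    kernel-injective y z y⇒z z⇒y = ∙-nondegenerate y z λ v → same (y ∙ v) (z ∙ v) (y⇒z v) (z⇒y v)
      where
      same : ∀ a b → (a ≡ false → b ≡ false) → (b ≡ false → a ≡ false) → a ≡ b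
      same false _     f g = sym (f refl)
      same true  false f g = g refl
      same true  true  f g = refl

  point : (x : V n) → x ≢ 𝟎 → Subspace n 1
  point x x≢𝟎 = record
    { vectors    = λ v → ∃ λ c → c · x ≡ v
    ; isSubspace = record
      { 𝟎-closed = false , ·-zero x
      ; ⊕-closed = λ { (c , refl) (d , refl) → c xor d , ·-distribʳ c d x }
      ; ·-closed = λ { false _ → false , trans (·-zero x) (sym (·-zero _))
                     ; true (c , eq) → c , trans eq (sym (·-one _)) }
      }
    ; dimension  = _ , imageBasis {f = λ { (c ∷ []) → c · x }}
        (λ { (c ∷ []) (d ∷ []) → ·-distribʳ c d x })
        (λ { (c ∷ []) → c , refl })
        (λ { (false ∷ []) _  → refl
           ; (true  ∷ []) eq → contradiction (trans (sym (·-one x)) eq) x≢𝟎 })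
        (λ { (c , eq) → c ∷ [] , eq })
    }

  module _ (P : Subspace n 1) where

    generator : V n
    generator = head (proj₁ (Subspace.dimension P))

    private
      open IsBasis (proj₂ (Subspace.dimension P))
      open IsSubspace (Subspace.isSubspace P)

      combination≡ : ∀ c → combination (c ∷ []) (proj₁ (Subspace.dimension P)) ≡ c · generator
      combination≡ c with _ ∷ [] ← proj₁ (Subspace.dimension P) = ⊕-identityʳ _

    generator≢𝟎 : generator ≢ 𝟎
    generator≢𝟎 eq with () ← independent (true ∷ [])
      (trans (combination≡ true) (trans (cong (true ·_) eq) (·-one 𝟎)))

    generator∈ : generator ∈ vectors P
    generator∈ with _ ∷ [] ← proj₁ (Subspace.dimension P) | x∈ ∷ [] ← members = x∈

    ∈⇒multiple : ∀ {v} → v ∈ vectors P → ∃ λ c → c · generator ≡ v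
    ∈⇒multiple v∈P with spanning v∈P
    ... | c ∷ [] , eq = c , trans (sym (combination≡ c)) eq

    multiple⇒∈ : ∀ {v} → (∃ λ c → c · generator ≡ v) → v ∈ vectors P
    multiple⇒∈ (c , refl) = ·-closed c generator∈

  -- The only nonzero multiple of a vector over GF(2) is the vector itself, so equal points have
  -- equal generators.
  points : Inverse (NonZeroVectors n) (SubspaceSetoid n 1)
  points = record
    { to        = λ (x , x≢𝟎) → point x x≢𝟎
    ; from      = λ P → generator P , generator≢𝟎 P
    ; to-cong   = λ { {_ , _} {_ , _} refl → (λ v∈ → v∈) , (λ v∈ → v∈) }
    ; from-cong = λ {P} {Q} (P⊆Q , _) →
                    multiple≢𝟎 (generator≢𝟎 P) (∈⇒multiple Q (P⊆Q (generator∈ P)))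
    ; inverse   = (λ { {P} refl → multiple⇒∈ P , ∈⇒multiple P })
                , (λ { {x , _} {P} (P⊆x , _) → multiple≢𝟎 (generator≢𝟎 P) (P⊆x (generator∈ P)) })
    }
    where
    multiple≢𝟎 : ∀ {x v : V n} → v ≢ 𝟎 → (∃ λ c → c · x ≡ v) → v ≡ x
    multiple≢𝟎 {x} v≢𝟎 (false , eq) = contradiction (trans (sym eq) (·-zero x)) v≢𝟎
    multiple≢𝟎 {x} v≢𝟎 (true  , eq) = trans (sym eq) (·-one x)

point⊆hyperplane⇒⊥ : ∀ {x y : V (suc n)} {x≢𝟎 y≢𝟎} →
  vectors (point x x≢𝟎) ⊆ vectors (hyperplane y y≢𝟎) → y ∙ x ≡ false
point⊆hyperplane⇒⊥ {x = x} x⊆y = x⊆y (true , ·-one x)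

⊥⇒point⊆hyperplane : ∀ {x y : V (suc n)} {x≢𝟎 y≢𝟎} → y ∙ x ≡ false →
  vectors (point x x≢𝟎) ⊆ vectors (hyperplane y y≢𝟎)
⊥⇒point⊆hyperplane {x = x} {y} yx (c , refl) =
  trans (∙-· c y x) (trans (cong (c ∧_) yx) (∧-zeroʳ c))

-- The Singer cycle of ℙ(5, GF(2))

_≟ⱽ_ : ∀ {n} (u v : V n) → Dec (u ≡ v)
_≟ⱽ_ = ≡-dec _≟_

allV? : ∀ {n} {P : Pred (V n) 0ℓ} → Decidable P → Dec (∀ v → P v)
allV? {zero}  P? = map′ (λ { p [] → p }) (λ p → p []) (P? [])
allV? {suc n} P? = map′
  (λ { (p , q) (false ∷ v) → p v ; (p , q) (true ∷ v) → q v })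
  (λ p → p ∘ (false ∷_) , p ∘ (true ∷_))
  (allV? (P? ∘ (false ∷_)) ×-dec allV? (P? ∘ (true ∷_)))

-- Bijectivity onto the nonzero vectors, phrased with quantifiers over finite types so that
-- exhaustive search decides it.
Enumerates : (Fin k → V n) → Set
Enumerates f = (∀ i → f i ≢ 𝟎) × (∀ i j → f i ≡ f j → i ≡ j) × (∀ v → v ≢ 𝟎 → ∃ λ i → f i ≡ v)

enumerates? : (f : Fin k → V n) → Dec (Enumerates f)
enumerates? f = Fin.all? (λ i → ¬? (f i ≟ⱽ 𝟎))
         ×-dec Fin.all? (λ i → Fin.all? λ j → (f i ≟ⱽ f j) →-dec (i Fin.≟ j))
         ×-dec allV? (λ v → ¬? (v ≟ⱽ 𝟎) →-dec Fin.any? λ i → f i ≟ⱽ v)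

enumeration : {f : Fin k → V n} → Enumerates f → Inverse (setoid (Fin k)) (NonZeroVectors n)
enumeration {f = f} (f≢𝟎 , injective , surjective) = record
  { to        = λ i → f i , f≢𝟎 i
  ; from      = λ (v , v≢𝟎) → proj₁ (surjective v v≢𝟎)
  ; to-cong   = cong f
  ; from-cong = λ {(u , u≢𝟎)} {(v , v≢𝟎)} u≡v → injective _ _
      (trans (proj₂ (surjective u u≢𝟎)) (trans u≡v (sym (proj₂ (surjective v v≢𝟎)))))
  ; inverse   = (λ { {v , v≢𝟎} refl → proj₂ (surjective v v≢𝟎) })
              , (λ { {_} {v , v≢𝟎} v≡fi → injective _ _ (trans (proj₂ (surjective v v≢𝟎)) v≡fi) })
  }

-- timesX is multiplication by X in GF(2)[X]/(X⁶ + X + 1), on coefficients from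
-- degree 0 upwards; shift, its transpose, advances a window of six terms of the
-- linear recurrence sₜ₊₆ = sₜ₊₁ + sₜ.
timesX shift : V 6 → V 6
timesX (a ∷ b ∷ c ∷ d ∷ e ∷ f ∷ []) = f ∷ (a xor f) ∷ b ∷ c ∷ d ∷ e ∷ []
shift  (a ∷ b ∷ c ∷ d ∷ e ∷ f ∷ []) = b ∷ c ∷ d ∷ e ∷ f ∷ (a xor b) ∷ []

power state : Fin 63 → V 6
power j = fold (true ∷ 𝟎) timesX (toℕ j)
state i = fold (true ∷ 𝟎) shift (toℕ i)

abstract
  -- The polynomial X⁶ + X + 1 is primitive: `X` generates the multiplicative group of the field
  -- with 64 elements. The proof is by evaluation.
  power-enumerates : Enumerates power
  power-enumerates = from-yes (enumerates? power)

  -- By the same primitivity the recurrence has the full period 63, and every nonzero window occurs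
  -- once in a period.
  state-enumerates : Enumerates state
  state-enumerates = from-yes (enumerates? state)

  -- Each `timesX` moves across the product as its transpose `shift`, leaving `i + j` shifts in all.
  -- Since `shift` has order 63, the sum may be reduced modulo 63. All pairs are checked by
  -- evaluation.
  power∙state : ∀ i j → power j ∙ state i ≡ power zero ∙ state (i ⊞ j)
  power∙state = from-yes (Fin.all? λ i → Fin.all? λ j →
    power j ∙ state i ≟ power zero ∙ state (i ⊞ j))

-- The set of offsets and the schedule with nine units

lookup-injective : ∀ {A : Set} {xs : List A} → Unique xs → Injective _≡_ _≡_ (lookup xs)
lookup-injective (_  ∷ _)  {zero}  {zero}  _  = refl
lookup-injective (x∉ ∷ _)  {zero}  {suc j} eq = contradiction eq (List.lookup x∉ (∈-lookup j))
lookup-injective (x∉ ∷ _)  {suc i} {zero}  eq = contradiction (sym eq) (List.lookup x∉ (∈-lookup i))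
lookup-injective (_  ∷ u)  {suc i} {suc j} eq = cong suc (lookup-injective u eq)

-- As `power zero` is the first unit vector, this says that term `d` of the recurrence sequence
-- vanishes.
Zero : Pred (Fin 63) 0ℓ
Zero d = power zero ∙ state d ≡ false

zero? : Decidable Zero
zero? d = power zero ∙ state d ≟ false

zeros : List (Fin 63)
zeros = filter zero? (allFin 63)

proposition1 : FoldedConflictFreeSchedule 9
-- There are 63 = 7 * 9 points and as many hyperplanes. The list `zeros` evaluates to one of length
-- 31, so 7 * 31 = 217 agrees with the prescribed number of steps.
proposition1 = Cyclic.cyclicSchedule 7 9 (pointHyperplaneGraph 5) left right
  (lookup zeros) (lookup-injective (filter⁺ zero? (allFin⁺ 63))) adjacent adjacent⁻¹
  where
  left : Inverse (setoid (Fin 63)) (SubspaceSetoid 6 1)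
  left = inverse (enumeration state-enumerates) points

  right : Inverse (setoid (Fin 63)) (SubspaceSetoid 6 5)
  right = inverse (enumeration power-enumerates) hyperplanes

  module left  = Inverse left
  module right = Inverse right

  adjacent : ∀ i j k → i ⊞ j ≡ lookup zeros k → vectors (left.to i) ⊆ vectors (right.to j)
  adjacent i j k eq = ⊥⇒point⊆hyperplane
    {x≢𝟎 = proj₁ state-enumerates i} {proj₁ power-enumerates j}
    (trans (power∙state i j)
      (subst Zero (sym eq) (proj₂ (∈-filter⁻ zero? {xs = allFin 63} (∈-lookup k)))))

  adjacent⁻¹ : ∀ P H → vectors P ⊆ vectors H → ∃ λ k → left.from P ⊞ right.from H ≡ lookup zeros k
  adjacent⁻¹ P H P⊆H = index d∈zeros , lookup-index d∈zeros
    where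
    i = left.from P
    j = right.from H
    d∈zeros : i ⊞ j ∈ˡ zeros
    d∈zeros = ∈-filter⁺ zero? (∈-allFin (i ⊞ j)) (trans (sym (power∙state i j))
      -- `P` and `H` agree with the subspaces built from their labels only up to mutual inclusion,
      -- so the incidence is carried across both inclusions.
      (point⊆hyperplane⇒⊥ {x≢𝟎 = proj₁ state-enumerates i} {proj₁ power-enumerates j} λ v∈ →
        proj₂ (right.strictlyInverseˡ H) (P⊆H (proj₁ (left.strictlyInverseˡ P) v∈))))
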